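{- If $G$ is a graph with no induced subgraph isomorphic to $2K_2$, then $\operatorname{reg}(G)\le\frac{1}{2}\Gamma(G)+2$.
   Context: $2K_2$ is the disjoint union of two edges. The maximum privacy degree is $\Gamma(G)=\max\{|N_G[x]\setminus N_G[y]|: x,y\in V(G),\ xy\in E(G)\}$ (taken over both orderings of each edge; $0$ if $G$ has no edges), where $N_G[x]=N_G(x)\cup\{x\}$. $\operatorname{reg}(G)=\max\{j\ge0:\widetilde H_{j-1}(\operatorname{Ind}(G[S]);\Bbbk)\neq0\text{ for some }S\subseteq V(G)\}$ over a field $\Bbbk$, $\operatorname{Ind}$ the independence complex. -}

module Defs where

open import Algebra.Apartness.Bundles using (HeytingField; HeytingCommutativeRing)
open import Algebra.Bundles using (CommutativeRing)
import Algebra.Properties.CommutativeMonoid.Sum as Sum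
import Algebra.Properties.Semiring.Exp as Exp
open import Data.Bool using (true; false; if_then_else_; _∨_)
open import Data.Empty using (⊥-elim)
open import Data.Fin using (Fin; zero; suc; #_; _≟_; _<?_)
open import Data.Fin.Subset using (Subset; ∣_∣; _∈_; _⊆_; _∪_; _∩_; _─_; ⁅_⁆; ⊥)
open import Data.Fin.Subset.Properties
  using (_∈?_; ∉⊥; x∈⁅x⁆; x∈p∪q⁺; ∣p∣≤n; ∣⊥∣≡0)
open import Data.List using (List; allFin; cartesianProduct; filter; map)
open import Data.List.Extrema.Nat using (max)
open import Data.Nat as ℕ using (ℕ; zero; suc; _≤_)
import Data.Nat.Properties as ℕₚ
open import Data.Product using (Σ; ∃; ∃-syntax; _×_; _,_)
open import Data.Sum using (inj₁; inj₂)
open import Data.Vec using (tabulate)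
open import Data.Vec.Properties using (≡-dec)
import Data.Bool.Properties as Boolₚ
open import Function.Bundles using (_⇔_)
open import Function.Definitions using (Injective)
open import Level using (0ℓ)
import Level
open import Relation.Binary using (Rel; Decidable; Symmetric)
open import Relation.Binary.PropositionalEquality as ≡ using (_≡_; refl)
open import Relation.Nullary using (¬_; yes; no; does; Dec)
open import Relation.Nullary.Decidable using (dec-true)

------------------------------------------------------------------------
-- Graphs

-- Finite simple graphs on the vertex set Fin n.
record Graph (n : ℕ) : Set₁ where
  infix 4 _~_ _~?_
  field
    _~_    : Rel (Fin n) 0ℓ
    _~?_   : Decidable _~_
    ~-sym  : Symmetric _~_
    ~-irrefl : ∀ {x} → ¬ (x ~ x)

HasInduced : ∀ {m n} → Graph m → Graph n → Set
HasInduced {m} {n} H G =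
  ∃[ f ] Injective {A = Fin m} {B = Fin n} _≡_ _≡_ f
       × (∀ i j → (i H.~ j) ⇔ (f i G.~ f j))
  where
  module H = Graph H
  module G = Graph G

data 2K₂-Adj : Rel (Fin 4) 0ℓ where
  e₀₁ : 2K₂-Adj (# 0) (# 1)
  e₁₀ : 2K₂-Adj (# 1) (# 0)
  e₂₃ : 2K₂-Adj (# 2) (# 3)
  e₃₂ : 2K₂-Adj (# 3) (# 2)

2K₂ : Graph 4
2K₂ = record
  { _~_ = 2K₂-Adj ; _~?_ = adj? ; ~-sym = symm ; ~-irrefl = λ () }
  where
  symm : Symmetric 2K₂-Adj
  symm e₀₁ = e₁₀
  symm e₁₀ = e₀₁
  symm e₂₃ = e₃₂
  symm e₃₂ = e₂₃

  adj? : Decidable 2K₂-Adj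
  adj? zero                   zero                   = no λ ()
  adj? zero                   (suc zero)             = yes e₀₁
  adj? zero                   (suc (suc _))          = no λ ()
  adj? (suc zero)             zero                   = yes e₁₀
  adj? (suc zero)             (suc _)                = no λ ()
  adj? (suc (suc zero))       zero                   = no λ ()
  adj? (suc (suc zero))       (suc zero)             = no λ ()
  adj? (suc (suc zero))       (suc (suc zero))       = no λ ()
  adj? (suc (suc zero))       (suc (suc (suc zero))) = yes e₂₃
  adj? (suc (suc (suc zero))) zero                   = no λ ()
  adj? (suc (suc (suc zero))) (suc zero)             = no λ ()
  adj? (suc (suc (suc zero))) (suc (suc zero))       = yes e₃₂
  adj? (suc (suc (suc zero))) (suc (suc (suc zero))) = no λ ()

module _ {n} (G : Graph n) where
  open Graph G

  N[_] : Fin n → Subset n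
  N[ x ] = tabulate λ y → does (x ≟ y) ∨ does (x ~? y)

  -- Both orderings of each edge occur in the list.
  orientedEdges : List (Fin n × Fin n)
  orientedEdges =
    filter (λ (x , y) → x ~? y) (cartesianProduct (allFin n) (allFin n))

  maxPrivacyDegree : ℕ
  maxPrivacyDegree = max 0 (map (λ (x , y) → ∣ N[ x ] ─ N[ y ] ∣) orientedEdges)

------------------------------------------------------------------------
-- Simplicial complexes and reduced homology

-- The empty set is allowed as a face (of dimension −1).
record SimplicialComplex (n : ℕ) : Set₁ where
  field
    IsFace     : Subset n → Set
    downClosed : ∀ {σ τ} → τ ⊆ σ → IsFace σ → IsFace τ

-- Ind G S is the independence complex of the induced subgraph G[S].
Ind : ∀ {n} → Graph n → Subset n → SimplicialComplex n
Ind G S = record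
  { IsFace     = λ σ → σ ⊆ S × (∀ {x y} → x ∈ σ → y ∈ σ → ¬ (x ~ y))
  ; downClosed = λ τ⊆σ (σ⊆S , ind) →
      (λ x∈τ → σ⊆S (τ⊆σ x∈τ)) , (λ x∈τ y∈τ → ind (τ⊆σ x∈τ) (τ⊆σ y∈τ))
  }
  where open Graph G

-- Classically, a HeytingField is exactly a field.
module Homology {c ℓ₁ ℓ₂} (K : HeytingField c ℓ₁ ℓ₂) where

  open HeytingField K using (heytingCommutativeRing)
  open HeytingCommutativeRing heytingCommutativeRing using (commutativeRing)
  open CommutativeRing commutativeRing
    using (Carrier; _≈_; _*_; -_; 0#; 1#; semiring; +-commutativeMonoid)
  open Sum +-commutativeMonoid using (sum)
  open Exp semiring using (_^_)

  module _ {n : ℕ} where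

    -- Number of elements of τ smaller than v, i.e. the index of v among the
    -- vertices of τ ∪ ⁅ v ⁆ listed in increasing order.
    position : Fin n → Subset n → ℕ
    position v τ = ∣ τ ∩ tabulate (λ w → does (w <? v)) ∣

    -- The coefficient of τ in ∂ (Σ_σ f(σ) σ), for the usual boundary
    -- ∂[v₀,…,v_k] = Σᵢ (-1)ⁱ [v₀,…,v̂ᵢ,…,v_k] with v₀ < … < v_k.  It is augmented:
    -- the boundary of every vertex is the empty face.
    ∂ : (Subset n → Carrier) → (Subset n → Carrier)
    ∂ f τ = sum λ v →
      if does (v ∈? τ) then 0# else (- 1#) ^ position v τ * f (τ ∪ ⁅ v ⁆)

    module _ (Δ : SimplicialComplex n) where
      open SimplicialComplex Δ

      -- Chain j is the space of (j−1)-dimensional chains: linear combinations of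
      -- the faces with j vertices, encoded as functions on all subsets that
      -- vanish elsewhere.
      record Chain (j : ℕ) : Set (c Level.⊔ ℓ₁) where
        field
          coeff     : Subset n → Carrier
          supported : ∀ σ → ¬ (IsFace σ × ∣ σ ∣ ≡ j) → coeff σ ≈ 0#
      open Chain public

      IsCycle : ∀ {j} → Chain j → Set ℓ₁
      IsCycle z = ∀ τ → ∂ (coeff z) τ ≈ 0#

      IsBoundary : ∀ {j} → Chain j → Set (c Level.⊔ ℓ₁)
      IsBoundary {j} z =
        Σ (Chain (suc j)) λ w → ∀ τ → ∂ (coeff w) τ ≈ coeff z τ

      -- H̃_{j−1}(Δ; K) ≠ 0; note the shift of the index by one.
      NonzeroH̃ : ℕ → Set (c Level.⊔ ℓ₁)
      NonzeroH̃ j = Σ (Chain j) λ z → IsCycle z × ¬ IsBoundary z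

open Homology using (NonzeroH̃)

------------------------------------------------------------------------
-- Regularity

-- IsReg K G r: r = max { j ≥ 0 : H̃_{j−1}(Ind(G[S]); K) ≠ 0 for some S }.
-- A relation rather than a function, since equality in K need not be decidable.
IsReg : ∀ {c ℓ₁ ℓ₂} → HeytingField c ℓ₁ ℓ₂ → ∀ {n} → Graph n → ℕ → Set (c Level.⊔ ℓ₁)
IsReg K G r = (∃[ S ] NonzeroH̃ K (Ind G S) r)
            × (∀ j S → NonzeroH̃ K (Ind G S) j → j ≤ r)

reg-unique : ∀ {c ℓ₁ ℓ₂} (K : HeytingField c ℓ₁ ℓ₂) {n} (G : Graph n) {r s} →
             IsReg K G r → IsReg K G s → r ≡ s
reg-unique K G ((S , hr) , ur) ((T , hs) , us) = ℕₚ.≤-antisym (us _ S hr) (ur _ T hs)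

-- Every graph has a regularity, up to double negation.
module _ {c ℓ₁ ℓ₂} (K : HeytingField c ℓ₁ ℓ₂) {n} (G : Graph n) where

  private
    open HeytingField K using (heytingCommutativeRing; invertible⇒#; #-irrefl)
    open HeytingCommutativeRing heytingCommutativeRing using (commutativeRing)
    module R = CommutativeRing commutativeRing
    open R using (Carrier; _≈_; _*_; -_; 0#; 1#)
    open Sum R.+-commutativeMonoid using (sum; sum-cong-≋; sum-replicate-zero)
    open Homology K hiding (NonzeroH̃)

    1≉0 : ¬ (1# ≈ 0#)
    1≉0 1≈0 = #-irrefl (R.refl {0#})
      (invertible⇒# (0# , R.trans (R.zeroˡ _) (R.sym 1≈0) , R.trans (R.zeroʳ _) (R.sym 1≈0)))

    ∂-zero : (f : Subset n → Carrier) (τ : Subset n) →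
             (∀ v → f (τ ∪ ⁅ v ⁆) ≈ 0#) → ∂ f τ ≈ 0#
    ∂-zero f τ h = R.trans
      (sum-cong-≋ {n = n} λ v → term (does (v ∈? τ)) _ (h v)) (sum-replicate-zero n)
      where
      term : ∀ b s {x} → x ≈ 0# → (if b then 0# else s * x) ≈ 0#
      term true  s x≈0 = R.refl
      term false s x≈0 = R.trans (R.*-congˡ x≈0) (R.zeroʳ s)

    bounded : ∀ j S → NonzeroH̃ K (Ind G S) j → j ≤ n
    bounded j S (z , _ , nb) with j ℕ.≤? n
    ... | yes j≤n = j≤n
    ... | no  j≰n = ⊥-elim (nb
      ( record { coeff = λ _ → 0# ; supported = λ _ _ → R.refl }
      , λ τ → R.trans (∂-zero _ τ λ _ → R.refl)
                      (R.sym (supported z τ λ { (_ , refl) → j≰n (∣p∣≤n τ) }))))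

    base : NonzeroH̃ K (Ind G ⊥) 0
    base = z , cycle , notBoundary
      where
      _≟ˢ_ : (σ τ : Subset n) → Dec (σ ≡ τ)
      _≟ˢ_ = ≡-dec Boolₚ._≟_

      f : Subset n → Carrier
      f σ = if does (σ ≟ˢ ⊥) then 1# else 0#

      f-≢ : ∀ σ → ¬ (σ ≡ ⊥) → f σ ≈ 0#
      f-≢ σ ≢⊥ with σ ≟ˢ ⊥
      ... | yes eq = ⊥-elim (≢⊥ eq)
      ... | no _   = R.refl

      f-⊥ : f ⊥ ≈ 1#
      f-⊥ rewrite dec-true (⊥ ≟ˢ ⊥) refl = R.refl

      z : Chain (Ind G ⊥) 0
      z = record
        { coeff     = f
        ; supported = λ σ h → f-≢ σ λ { refl →
            h (((λ x → x) , λ x∈⊥ → ⊥-elim (∉⊥ x∈⊥)) , ∣⊥∣≡0 n) }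
        }

      cycle : IsCycle (Ind G ⊥) z
      cycle τ = ∂-zero f τ λ v → f-≢ (τ ∪ ⁅ v ⁆) λ eq →
        ∉⊥ (≡.subst (v ∈_) eq (x∈p∪q⁺ {p = τ} (inj₂ (x∈⁅x⁆ v))))

      notBoundary : ¬ IsBoundary (Ind G ⊥) z
      notBoundary (w , ∂w≈z) = 1≉0 (R.trans (R.sym f-⊥) (R.trans (R.sym (∂w≈z ⊥))
        (∂-zero (coeff w) ⊥ λ v → supported w _ λ { ((⊆⊥ , _) , _) →
          ∉⊥ (⊆⊥ (x∈p∪q⁺ {p = ⊥} (inj₂ (x∈⁅x⁆ v)))) })))

    -- Search downwards from an upper bound b.
    search : ∀ b → (∀ j S → NonzeroH̃ K (Ind G S) j → j ≤ b) → ¬ ¬ ∃ (IsReg K G)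
    search zero    ub k = k (zero , (⊥ , base) , ub)
    search (suc b) ub k = search b lower k
      where
      lower : ∀ j S → NonzeroH̃ K (Ind G S) j → j ≤ b
      lower j S h with ℕₚ.m≤n⇒m<n∨m≡n (ub j S h)
      ... | inj₁ j<1+b = ℕₚ.≤-pred j<1+b
      ... | inj₂ refl  = ⊥-elim (k (suc b , (S , h) , ub))

  reg-exists : ¬ ¬ ∃ (IsReg K G)
  reg-exists = search n bounded

{-# OPTIONS --safe #-}

-- Everything rests on the long exact sequence of a vertex v ∈ S: if
-- H̃_j(Ind(S − v)) = 0 and H̃_{j−1}(Ind(S − N[v])) = 0 then H̃_j(Ind(S)) = 0.
-- In a 2K₂-free graph the edges of S − N[x] are covered by C = N[y] \ N[x]
-- for every edge xy, and |C| ≤ Γ.  So it is enough that a vertex cover C gives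
-- reg ≤ |C|/2 + 1, by induction on |C|.  If c, d ∈ C are adjacent, deleting c
-- removes one vertex of C and deleting N[c] removes two.  If C is independent,
-- some vertex c ∈ C leaves S − N[c] either edgeless or with an isolated vertex,
-- so that only S − c matters.

module Submission where

open import Defs
open import Algebra.Apartness.Bundles using (HeytingField; HeytingCommutativeRing)
open import Algebra.Bundles using (CommutativeRing)
import Algebra.Properties.Group as GroupProperties
import Algebra.Properties.Ring as RingProperties
import Algebra.Properties.Semiring.Exp as Exp
import Algebra.Properties.Semiring.Sum as Sum
open import Data.Bool using (if_then_else_)
open import Data.Empty using (⊥-elim)
open import Data.Fin as Fin using (Fin; zero; suc; _<?_)
open import Data.Fin.Patterns using (0F; 1F; 2F; 3F)
import Data.Fin.Properties as Finₚ
open import Data.Fin.Subset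
  using (Subset; inside; outside; ∣_∣; _∈_; _∉_; _⊆_; _∪_; _∩_; _─_; _-_; ⁅_⁆; Empty; Nonempty)
open import Data.Fin.Subset.Properties
open import Data.List.Extrema.Nat using (xs≤max)
open import Data.List.Membership.Propositional.Properties
  using (∈-map⁺; ∈-filter⁺; ∈-cartesianProduct⁺; ∈-allFin)
import Data.List.Relation.Unary.All as All
open import Data.Nat using (ℕ; zero; suc; _+_; _*_; _≤_; _<_; s≤s)
open import Data.Nat.Induction using (<-wellFounded)
import Data.Nat.Properties as ℕₚ
open import Data.Product using (∃-syntax; _×_; _,_)
open import Data.Sum using (_⊎_; inj₁; inj₂; [_,_]′)
open import Data.Vec using ([]; _∷_; lookup; here; there; tabulate)
open import Data.Vec.Properties using (lookup⇒[]=; []=⇒lookup; lookup∘tabulate)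
open import Function using (_∘_)
open import Function.Bundles using (mk⇔)
open import Induction.WellFounded using (Acc; acc)
open import Relation.Binary using (tri<; tri≈; tri>)
open import Relation.Binary.PropositionalEquality as ≡ using (_≡_; _≢_; refl)
open import Relation.Nullary using (¬_; yes; no; does; Dec)
open import Relation.Nullary.Decidable using (dec-true; _×-dec_; _⊎-dec_)

-- Finite subsets: membership, insertion, deletion and size.

private
  variable
    n : ℕ

module _ {p} {P : Fin n → Set p} (P? : ∀ x → Dec (P x)) where

  ∈-tabulate-does⁺ : ∀ {x} → P x → x ∈ tabulate (does ∘ P?)
  ∈-tabulate-does⁺ {x} px = lookup⇒[]= x _
    (≡.trans (lookup∘tabulate (does ∘ P?) x) (dec-true (P? x) px))

  ∈-tabulate-does⁻ : ∀ {x} → x ∈ tabulate (does ∘ P?) → P x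
  ∈-tabulate-does⁻ {x} x∈
    with P? x | ≡.trans (≡.sym (lookup∘tabulate (does ∘ P?) x)) ([]=⇒lookup x∈)
  ... | yes px | _ = px
  ... | no _   | ()

x∈p─q⇒x∉q : ∀ {x} (p q : Subset n) → x ∈ p ─ q → x ∉ q
x∈p─q⇒x∉q (_ ∷ p) (_ ∷ q) (there x∈) (there x∈q) = x∈p─q⇒x∉q p q x∈ x∈q
x∈p─q⇒x∉q (_ ∷ p) (inside ∷ q) () here

x∉p-x : ∀ (p : Subset n) {x} → x ∉ p - x
x∉p-x p x∈ = x∈p─q⇒x∉q p _ x∈ (x∈⁅x⁆ _)

x∈p∪⁅x⁆ : ∀ (p : Subset n) {x} → x ∈ p ∪ ⁅ x ⁆
x∈p∪⁅x⁆ p = q⊆p∪q p _ (x∈⁅x⁆ _)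

x∈p∪⁅y⁆⁻ : ∀ (p : Subset n) {x y} → x ∈ p ∪ ⁅ y ⁆ → x ∈ p ⊎ x ≡ y
x∈p∪⁅y⁆⁻ p x∈ with x∈p∪q⁻ p _ x∈
... | inj₁ x∈p = inj₁ x∈p
... | inj₂ x∈y = inj₂ (x∈⁅y⁆⇒x≡y _ x∈y)

x∉p∪⁅y⁆ : ∀ {p : Subset n} {x y} → x ∉ p → x ≢ y → x ∉ p ∪ ⁅ y ⁆
x∉p∪⁅y⁆ {p = p} x∉p x≢y = [ x∉p , x≢y ]′ ∘ x∈p∪⁅y⁆⁻ p

∪⁅⁆-swap : ∀ (p : Subset n) x y → (p ∪ ⁅ x ⁆) ∪ ⁅ y ⁆ ≡ (p ∪ ⁅ y ⁆) ∪ ⁅ x ⁆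
∪⁅⁆-swap p x y = ≡.trans (∪-assoc p _ _)
  (≡.trans (≡.cong (p ∪_) (∪-comm ⁅ x ⁆ ⁅ y ⁆)) (≡.sym (∪-assoc p _ _)))

p-x∪⁅x⁆≡p : ∀ {p : Subset n} {x} → x ∈ p → (p - x) ∪ ⁅ x ⁆ ≡ p
p-x∪⁅x⁆≡p {p = p} {x} x∈p = ⊆-antisym to from
  where
  to : (p - x) ∪ ⁅ x ⁆ ⊆ p
  to y∈ with x∈p∪⁅y⁆⁻ (p - x) y∈
  ... | inj₁ y∈p-x = p─q⊆p p _ y∈p-x
  ... | inj₂ refl  = x∈p
  from : p ⊆ (p - x) ∪ ⁅ x ⁆
  from {y} y∈p with y Fin.≟ x
  ... | yes refl = x∈p∪⁅x⁆ (p - x)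
  ... | no y≢x   = p⊆p∪q _ (x∈p∧x≢y⇒x∈p-y y∈p y≢x)

p∪⁅x⁆-x≡p : ∀ {p : Subset n} {x} → x ∉ p → (p ∪ ⁅ x ⁆) - x ≡ p
p∪⁅x⁆-x≡p {p = p} {x} x∉p = ⊆-antisym to from
  where
  to : (p ∪ ⁅ x ⁆) - x ⊆ p
  to y∈ with x∈p∪⁅y⁆⁻ p (p─q⊆p (p ∪ ⁅ x ⁆) _ y∈)
  ... | inj₁ y∈p  = y∈p
  ... | inj₂ refl = ⊥-elim (x∉p-x (p ∪ ⁅ x ⁆) y∈)
  from : p ⊆ (p ∪ ⁅ x ⁆) - x
  from y∈p = x∈p∧x≢y⇒x∈p-y (p⊆p∪q _ y∈p) λ { refl → x∉p y∈p }

∣p∪⁅x⁆∣≡1+∣p∣ : ∀ {p : Subset n} {x} → x ∉ p → ∣ p ∪ ⁅ x ⁆ ∣ ≡ suc ∣ p ∣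
∣p∪⁅x⁆∣≡1+∣p∣ {p = inside ∷ p}  {zero}  x∉p = ⊥-elim (x∉p here)
∣p∪⁅x⁆∣≡1+∣p∣ {p = outside ∷ p} {zero}  x∉p = ≡.cong (suc ∘ ∣_∣) (∪-identityʳ p)
∣p∪⁅x⁆∣≡1+∣p∣ {p = inside ∷ p}  {suc x} x∉p = ≡.cong suc (∣p∪⁅x⁆∣≡1+∣p∣ (x∉p ∘ there))
∣p∪⁅x⁆∣≡1+∣p∣ {p = outside ∷ p} {suc x} x∉p = ∣p∪⁅x⁆∣≡1+∣p∣ (x∉p ∘ there)

empty⇒∣p∣≡0 : ∀ {p : Subset n} → Empty p → ∣ p ∣ ≡ 0
empty⇒∣p∣≡0 {n} empty = ≡.trans (≡.cong ∣_∣ (Empty-unique empty)) (∣⊥∣≡0 n)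

-- Passing to a link lowers the homological index by one, so a bound against twice the index loses
-- two on both sides.
2+m≤2*[1+k]⇒m≤2*k : ∀ {m k} → 2 + m ≤ 2 * suc k → m ≤ 2 * k
2+m≤2*[1+k]⇒m≤2*k {m} {k} le =
  ℕₚ.+-cancelˡ-≤ 2 m (2 * k) (≡.subst (2 + m ≤_) (ℕₚ.*-suc 2 k) le)

-- Closed neighbourhoods, privacy degree and pairs of edges.

module GraphProperties {n} (G : Graph n) where

  open Graph G

  ∈N⁺ : ∀ {v x} → v ≡ x ⊎ v ~ x → x ∈ N[ G ] v
  ∈N⁺ {v} = ∈-tabulate-does⁺ (λ x → (v Fin.≟ x) ⊎-dec (v ~? x))

  ∈N⁻ : ∀ {v x} → x ∈ N[ G ] v → v ≡ x ⊎ v ~ x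
  ∈N⁻ {v} = ∈-tabulate-does⁻ (λ x → (v Fin.≟ x) ⊎-dec (v ~? x))

  ─N⊆- : ∀ {S v} → S ─ N[ G ] v ⊆ S - v
  ─N⊆- {S} {v} x∈ = x∈p∧x≢y⇒x∈p-y (p─q⊆p S _ x∈)
    λ { refl → x∈p─q⇒x∉q S _ x∈ (∈N⁺ (inj₁ refl)) }

  ∣N─N∣≤maxPrivacyDegree : ∀ {x y} → x ~ y → ∣ N[ G ] x ─ N[ G ] y ∣ ≤ maxPrivacyDegree G
  ∣N─N∣≤maxPrivacyDegree {x} {y} x~y = All.lookup (xs≤max 0 _)
    (∈-map⁺ _ (∈-filter⁺ (λ (x , y) → x ~? y)
      (∈-cartesianProduct⁺ (∈-allFin x) (∈-allFin y)) x~y))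

  HasEdge : Subset n → Set
  HasEdge S = ∃[ x ] ∃[ y ] x ∈ S × y ∈ S × x ~ y

  hasEdge? : ∀ S → Dec (HasEdge S)
  hasEdge? S = Finₚ.any? λ x → Finₚ.any? λ y → (x ∈? S) ×-dec (y ∈? S) ×-dec (x ~? y)

  -- With no adjacency between the two edges, their four endpoints would induce `2K₂`. Edges sharing
  -- an endpoint are included: if `x` is `u`, then `x ~ v`.
  2K₂-free⇒linked : ¬ HasInduced 2K₂ G → ∀ {x y u v} → x ~ y → u ~ v →
                    (x ~ u ⊎ x ~ v) ⊎ (y ~ u ⊎ y ~ v)
  2K₂-free⇒linked 2K₂-free {x} {y} {u} {v} x~y u~v
    with ((x ~? u) ⊎-dec (x ~? v)) ⊎-dec ((y ~? u) ⊎-dec (y ~? v))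
  ... | yes linked = linked
  ... | no ¬linked = ⊥-elim (2K₂-free
          (f , injective , λ i j → mk⇔ preserves (reflects i j)))
    where
    f : Fin 4 → Fin n
    f = lookup (x ∷ y ∷ u ∷ v ∷ [])
    preserves : ∀ {i j} → 2K₂-Adj i j → f i ~ f j
    preserves e₀₁ = x~y
    preserves e₁₀ = ~-sym x~y
    preserves e₂₃ = u~v
    preserves e₃₂ = ~-sym u~v
    x≁u : ¬ x ~ u
    x≁u = ¬linked ∘ inj₁ ∘ inj₁
    x≁v : ¬ x ~ v
    x≁v = ¬linked ∘ inj₁ ∘ inj₂
    y≁u : ¬ y ~ u
    y≁u = ¬linked ∘ inj₂ ∘ inj₁
    y≁v : ¬ y ~ v
    y≁v = ¬linked ∘ inj₂ ∘ inj₂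
    reflects : ∀ i j → f i ~ f j → 2K₂-Adj i j
    reflects 0F 0F e = ⊥-elim (~-irrefl e)
    reflects 0F 1F e = e₀₁
    reflects 0F 2F e = ⊥-elim (x≁u e)
    reflects 0F 3F e = ⊥-elim (x≁v e)
    reflects 1F 0F e = e₁₀
    reflects 1F 1F e = ⊥-elim (~-irrefl e)
    reflects 1F 2F e = ⊥-elim (y≁u e)
    reflects 1F 3F e = ⊥-elim (y≁v e)
    reflects 2F 0F e = ⊥-elim (x≁u (~-sym e))
    reflects 2F 1F e = ⊥-elim (y≁u (~-sym e))
    reflects 2F 2F e = ⊥-elim (~-irrefl e)
    reflects 2F 3F e = e₂₃
    reflects 3F 0F e = ⊥-elim (x≁v (~-sym e))
    reflects 3F 1F e = ⊥-elim (y≁v (~-sym e))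
    reflects 3F 2F e = e₃₂
    reflects 3F 3F e = ⊥-elim (~-irrefl e)
    mate : ∀ i → ∃[ j ] 2K₂-Adj i j
    mate 0F = 1F , e₀₁
    mate 1F = 0F , e₁₀
    mate 2F = 3F , e₂₃
    mate 3F = 2F , e₃₂
    mate-unique : ∀ {i j k} → 2K₂-Adj i k → 2K₂-Adj j k → i ≡ j
    mate-unique e₀₁ e₀₁ = refl
    mate-unique e₁₀ e₁₀ = refl
    mate-unique e₂₃ e₂₃ = refl
    mate-unique e₃₂ e₃₂ = refl
    -- If f i ≡ f j then i and j are adjacent to the same vertex of 2K₂.
    injective : ∀ {i j} → f i ≡ f j → i ≡ j
    injective {i} {j} fi≡fj = let k , i~k = mate i in
      mate-unique i~k (reflects j k (≡.subst (_~ f k) fi≡fj (preserves i~k)))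

  -- Faces and links in independence complexes.

  Face : Subset n → Subset n → Set
  Face S = SimplicialComplex.IsFace (Ind G S)

  face-mono : ∀ {S T σ} → S ⊆ T → Face S σ → Face T σ
  face-mono S⊆T (σ⊆S , ind) = S⊆T ∘ σ⊆S , ind

  -- Together with `face-cone` this identifies the link of `v` in `Ind G S` with the independence
  -- complex on `S ─ N[ G ] v`.
  face-link : ∀ {S v τ} → v ∉ τ → Face S (τ ∪ ⁅ v ⁆) → Face (S ─ N[ G ] v) τ
  face-link {S} {v} {τ} v∉τ (τv⊆S , ind) = inLink , λ x∈τ y∈τ → ind (p⊆p∪q _ x∈τ) (p⊆p∪q _ y∈τ)
    where
    inLink : τ ⊆ S ─ N[ G ] v
    inLink x∈τ = x∈p∧x∉q⇒x∈p─q (τv⊆S (p⊆p∪q _ x∈τ))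
      λ x∈N → [ (λ { refl → v∉τ x∈τ })
              , ind (x∈p∪⁅x⁆ τ) (p⊆p∪q _ x∈τ) ]′ (∈N⁻ x∈N)

  face-cone : ∀ {S v τ} → v ∈ S → Face (S ─ N[ G ] v) τ → Face S (τ ∪ ⁅ v ⁆)
  face-cone {S} {v} {τ} v∈S (τ⊆L , ind) = inS , indep
    where
    v≁ : ∀ {x} → x ∈ τ → ¬ v ~ x
    v≁ x∈τ v~x = x∈p─q⇒x∉q S _ (τ⊆L x∈τ) (∈N⁺ (inj₂ v~x))
    inS : τ ∪ ⁅ v ⁆ ⊆ S
    inS x∈ with x∈p∪⁅y⁆⁻ τ x∈
    ... | inj₁ x∈τ  = p─q⊆p S _ (τ⊆L x∈τ)
    ... | inj₂ refl = v∈S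
    indep : ∀ {x y} → x ∈ τ ∪ ⁅ v ⁆ → y ∈ τ ∪ ⁅ v ⁆ → ¬ x ~ y
    indep x∈ y∈ x~y with x∈p∪⁅y⁆⁻ τ x∈ | x∈p∪⁅y⁆⁻ τ y∈
    ... | inj₁ x∈τ  | inj₁ y∈τ  = ind x∈τ y∈τ x~y
    ... | inj₁ x∈τ  | inj₂ refl = v≁ x∈τ (~-sym x~y)
    ... | inj₂ refl | inj₁ y∈τ  = v≁ y∈τ x~y
    ... | inj₂ refl | inj₂ refl = ~-irrefl x~y

  -- Vertex covers.

  module Cover (C : Subset n) where

    -- `C` stays fixed while `S` shrinks in the induction; the actual cover of `S` is `C ∩ S`, whose
    -- size is the induction measure.
    Covers : Subset n → Set
    Covers S = ∀ {x y} → x ∈ S → y ∈ S → x ~ y → x ∈ C ⊎ y ∈ C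

    covers-anti : ∀ {S T} → S ⊆ T → Covers T → Covers S
    covers-anti S⊆T cov x∈S y∈S = cov (S⊆T x∈S) (S⊆T y∈S)

    ∣C∩S-c∣<∣C∩S∣ : ∀ {S c} → c ∈ C → c ∈ S → ∣ C ∩ (S - c) ∣ < ∣ C ∩ S ∣
    ∣C∩S-c∣<∣C∩S∣ {S} {c} c∈C c∈S = p⊂q⇒∣p∣<∣q∣
      ( (λ x∈ → let x∈C , x∈S-c = x∈p∩q⁻ C _ x∈ in x∈p∩q⁺ (x∈C , p─q⊆p S _ x∈S-c))
      , c , x∈p∩q⁺ (c∈C , c∈S) , λ c∈ → x∉p-x S (p∩q⊆q C _ c∈))

    -- Both `c` and `d` lie in `N[ G ] c`, so two elements of the cover leave at once. This pays for
    -- lowering the homological index by one.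
    2+∣C∩S─N∣≤∣C∩S∣ : ∀ {S c d} → c ∈ C ∩ S → d ∈ C ∩ S → c ~ d →
                     2 + ∣ C ∩ (S ─ N[ G ] c) ∣ ≤ ∣ C ∩ S ∣
    2+∣C∩S─N∣≤∣C∩S∣ {S} {c} {d} c∈ d∈ c~d = ℕₚ.≤-trans
      (s≤s (ℕₚ.≤-trans (s≤s (p⊆q⇒∣p∣≤∣q∣ avoid)) (x∈p⇒∣p-x∣<∣p∣ d∈C∩S-c)))
      (x∈p⇒∣p-x∣<∣p∣ c∈)
      where
      d∈C∩S-c : d ∈ (C ∩ S) - c
      d∈C∩S-c = x∈p∧x≢y⇒x∈p-y d∈ λ { refl → ~-irrefl c~d }
      avoid : C ∩ (S ─ N[ G ] c) ⊆ (C ∩ S) - c - d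
      avoid x∈ =
        let x∈C , x∈L = x∈p∩q⁻ C _ x∈
            x∉N = x∈p─q⇒x∉q S _ x∈L
        in x∈p∧x≢y⇒x∈p-y
             (x∈p∧x≢y⇒x∈p-y (x∈p∩q⁺ (x∈C , p─q⊆p S _ x∈L))
               λ { refl → x∉N (∈N⁺ (inj₁ refl)) })
             λ { refl → x∉N (∈N⁺ (inj₂ c~d)) }

-- Sums, signs and the boundary operator.

module _ {c ℓ₁ ℓ₂} (K : HeytingField c ℓ₁ ℓ₂) where

  open Homology K
  open HeytingField K using (heytingCommutativeRing)
  open HeytingCommutativeRing heytingCommutativeRing using (commutativeRing)
  private
    module R = CommutativeRing commutativeRing
  open R using (Carrier; _≈_; 0#; 1#; -_; setoid)
    renaming (_+_ to _⊕_; _*_ to _⊛_)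
  open Exp R.semiring using (_^_)
  open Sum R.semiring using (sum; sum-cong-≋; sum-replicate-zero; ∑-distrib-+; *-distribˡ-sum)
  open GroupProperties R.+-group using (inverseˡ-unique; inverseʳ-unique; ⁻¹-involutive; ε⁻¹≈ε)
  open RingProperties R.ring using (-1*x≈-x; -‿distribˡ-*; -‿distribʳ-*)
  open import Relation.Binary.Reasoning.Setoid setoid

  -x*-y≈x*y : ∀ x y → - x ⊛ - y ≈ x ⊛ y
  -x*-y≈x*y x y = begin
    - x ⊛ - y      ≈⟨ R.sym (-‿distribˡ-* x (- y)) ⟩
    - (x ⊛ - y)    ≈⟨ R.-‿cong (R.sym (-‿distribʳ-* x y)) ⟩
    - (- (x ⊛ y))  ≈⟨ ⁻¹-involutive _ ⟩
    x ⊛ y          ∎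

  sum-zero : ∀ (t : Fin n → Carrier) → (∀ i → t i ≈ 0#) → sum t ≈ 0#
  sum-zero {n} t h = R.trans (sum-cong-≋ h) (sum-replicate-zero n)

  sum-single : ∀ (i : Fin n) (t : Fin n → Carrier) →
               (∀ j → j ≢ i → t j ≈ 0#) → sum t ≈ t i
  sum-single zero    t h = R.trans
    (R.+-congˡ (sum-zero (t ∘ suc) λ j → h (suc j) λ ())) (R.+-identityʳ _)
  sum-single (suc i) t h = R.trans
    (R.+-cong (h zero λ ()) (sum-single i (t ∘ suc) λ j j≢i →
      h (suc j) (j≢i ∘ Finₚ.suc-injective)))
    (R.+-identityˡ _)

  sgn : Fin n → Subset n → Carrier
  sgn v τ = (- 1#) ^ position v τ

  sgn-involutive : ∀ (v : Fin n) τ x → sgn v τ ⊛ (sgn v τ ⊛ x) ≈ x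
  sgn-involutive v τ x = R.trans (R.sym (R.*-assoc _ _ x))
    (R.trans (R.*-congʳ (square (position v τ))) (R.*-identityˡ x))
    where
    square : ∀ k → (- 1#) ^ k ⊛ (- 1#) ^ k ≈ 1#
    square zero    = R.*-identityˡ 1#
    square (suc k) = R.trans (R.*-cong (-1*x≈-x _) (-1*x≈-x _))
                             (R.trans (-x*-y≈x*y _ _) (square k))

  sgn-insert-< : ∀ {u v : Fin n} {τ} → u Fin.< v → u ∉ τ →
                 sgn v (τ ∪ ⁅ u ⁆) ≈ - sgn v τ
  sgn-insert-< {u = u} {v} {τ} u<v u∉τ =
    R.trans (R.reflexive (≡.cong ((- 1#) ^_) eq)) (-1*x≈-x _)
    where
    below = tabulate λ w → does (w <? v)
    u∈below : u ∈ below
    u∈below = ∈-tabulate-does⁺ (_<? v) u<v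
    eq : position v (τ ∪ ⁅ u ⁆) ≡ suc (position v τ)
    eq = ≡.trans (≡.cong ∣_∣ (⊆-antisym to from))
                 (∣p∪⁅x⁆∣≡1+∣p∣ λ u∈ → u∉τ (p∩q⊆p τ below u∈))
      where
      to : (τ ∪ ⁅ u ⁆) ∩ below ⊆ (τ ∩ below) ∪ ⁅ u ⁆
      to x∈ with x∈p∩q⁻ (τ ∪ ⁅ u ⁆) below x∈
      ... | x∈τu , x∈b with x∈p∪⁅y⁆⁻ τ x∈τu
      ...   | inj₁ x∈τ  = p⊆p∪q _ (x∈p∩q⁺ (x∈τ , x∈b))
      ...   | inj₂ refl = x∈p∪⁅x⁆ (τ ∩ below)
      from : (τ ∩ below) ∪ ⁅ u ⁆ ⊆ (τ ∪ ⁅ u ⁆) ∩ below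
      from x∈ with x∈p∪⁅y⁆⁻ (τ ∩ below) x∈
      ... | inj₁ x∈τb = let x∈τ , x∈b = x∈p∩q⁻ τ below x∈τb in
                        x∈p∩q⁺ (p⊆p∪q _ x∈τ , x∈b)
      ... | inj₂ refl = x∈p∩q⁺ (x∈p∪⁅x⁆ τ , u∈below)

  sgn-insert-≮ : ∀ {u v : Fin n} {τ} → ¬ u Fin.< v → sgn v (τ ∪ ⁅ u ⁆) ≈ sgn v τ
  sgn-insert-≮ {u = u} {v} {τ} u≮v =
    R.reflexive (≡.cong (λ σ → (- 1#) ^ ∣ σ ∣) (⊆-antisym to from))
    where
    below = tabulate λ w → does (w <? v)
    u∉below : u ∉ below
    u∉below = u≮v ∘ ∈-tabulate-does⁻ (_<? v)
    to : (τ ∪ ⁅ u ⁆) ∩ below ⊆ τ ∩ below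
    to x∈ with x∈p∩q⁻ (τ ∪ ⁅ u ⁆) below x∈
    ... | x∈τu , x∈b with x∈p∪⁅y⁆⁻ τ x∈τu
    ...   | inj₁ x∈τ  = x∈p∩q⁺ (x∈τ , x∈b)
    ...   | inj₂ refl = ⊥-elim (u∉below x∈b)
    from : τ ∩ below ⊆ (τ ∪ ⁅ u ⁆) ∩ below
    from x∈ = let x∈τ , x∈b = x∈p∩q⁻ τ below x∈ in x∈p∩q⁺ (p⊆p∪q _ x∈τ , x∈b)

  -- Exactly one of `u` and `v` lies below the other, so only one of the two insertions shifts a
  -- position. This is the sign rule behind the vanishing of ∂∂.
  sgn-swap : ∀ {u v : Fin n} {τ} → u ≢ v → u ∉ τ → v ∉ τ →
             sgn u τ ⊛ sgn v (τ ∪ ⁅ u ⁆) ≈ - (sgn v τ ⊛ sgn u (τ ∪ ⁅ v ⁆))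
  sgn-swap {u = u} {v} {τ} u≢v u∉τ v∉τ with Finₚ.<-cmp u v
  ... | tri≈ _ u≡v _ = ⊥-elim (u≢v u≡v)
  ... | tri< u<v _ v≮u = begin
    sgn u τ ⊛ sgn v (τ ∪ ⁅ u ⁆)     ≈⟨ R.*-congˡ (sgn-insert-< u<v u∉τ) ⟩
    sgn u τ ⊛ - sgn v τ             ≈⟨ R.sym (-‿distribʳ-* _ _) ⟩
    - (sgn u τ ⊛ sgn v τ)           ≈⟨ R.-‿cong (R.*-comm _ _) ⟩
    - (sgn v τ ⊛ sgn u τ)           ≈⟨ R.-‿cong (R.*-congˡ (R.sym (sgn-insert-≮ {τ = τ} v≮u))) ⟩
    - (sgn v τ ⊛ sgn u (τ ∪ ⁅ v ⁆)) ∎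
  ... | tri> u≮v _ v<u = begin
    sgn u τ ⊛ sgn v (τ ∪ ⁅ u ⁆)     ≈⟨ R.*-congˡ (sgn-insert-≮ {τ = τ} u≮v) ⟩
    sgn u τ ⊛ sgn v τ               ≈⟨ R.*-comm _ _ ⟩
    sgn v τ ⊛ sgn u τ               ≈⟨ R.sym (⁻¹-involutive _) ⟩
    - - (sgn v τ ⊛ sgn u τ)         ≈⟨ R.-‿cong (-‿distribʳ-* _ _) ⟩
    - (sgn v τ ⊛ - sgn u τ)         ≈⟨ R.-‿cong (R.*-congˡ (R.sym (sgn-insert-< v<u v∉τ))) ⟩
    - (sgn v τ ⊛ sgn u (τ ∪ ⁅ v ⁆)) ∎

  -- The summand of `∂`, kept in the same form so that `∂ f τ` is `sum (term f τ)` by definition.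
  term : (Subset n → Carrier) → Subset n → Fin n → Carrier
  term f τ v = if does (v ∈? τ) then 0# else sgn v τ ⊛ f (τ ∪ ⁅ v ⁆)

  term-∈ : ∀ (f : Subset n → Carrier) {τ v} → v ∈ τ → term f τ v ≈ 0#
  term-∈ f {τ} {v} v∈τ with v ∈? τ
  ... | yes _  = R.refl
  ... | no v∉τ = ⊥-elim (v∉τ v∈τ)

  term-∉ : ∀ (f : Subset n → Carrier) {τ v} → v ∉ τ →
           term f τ v ≈ sgn v τ ⊛ f (τ ∪ ⁅ v ⁆)
  term-∉ f {τ} {v} v∉τ with v ∈? τ
  ... | yes v∈τ = ⊥-elim (v∉τ v∈τ)
  ... | no _    = R.refl

  term-zero : ∀ (f : Subset n → Carrier) τ v → f (τ ∪ ⁅ v ⁆) ≈ 0# → term f τ v ≈ 0#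
  term-zero f τ v h with v ∈? τ
  ... | yes _ = R.refl
  ... | no _  = R.trans (R.*-congˡ h) (R.zeroʳ _)

  ∂-zero : ∀ (f : Subset n → Carrier) τ → (∀ v → f (τ ∪ ⁅ v ⁆) ≈ 0#) → ∂ f τ ≈ 0#
  ∂-zero f τ h = sum-zero (term f τ) λ v → term-zero f τ v (h v)

  ∂-cong : ∀ {f g : Subset n → Carrier} → (∀ σ → f σ ≈ g σ) → ∀ τ → ∂ f τ ≈ ∂ g τ
  ∂-cong {n} {f} {g} f≈g τ = sum-cong-≋ {x = term f τ} {term g τ} termwise
    where
    termwise : ∀ v → term f τ v ≈ term g τ v
    termwise v with v ∈? τ
    ... | yes _ = R.refl
    ... | no _  = R.*-congˡ (f≈g _)

  ∂-+ : ∀ (f g : Subset n → Carrier) τ → ∂ (λ σ → f σ ⊕ g σ) τ ≈ ∂ f τ ⊕ ∂ g τ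
  ∂-+ f g τ = R.trans (sum-cong-≋ termwise) (∑-distrib-+ (term f τ) (term g τ))
    where
    termwise : ∀ v → term (λ σ → f σ ⊕ g σ) τ v ≈ term f τ v ⊕ term g τ v
    termwise v with v ∈? τ
    ... | yes _ = R.sym (R.+-identityˡ 0#)
    ... | no _  = R.distribˡ _ _ _

  ∂-neg : ∀ (f : Subset n → Carrier) τ → ∂ (λ σ → - f σ) τ ≈ - ∂ f τ
  ∂-neg f τ = inverseʳ-unique _ _ (R.trans (R.sym (∂-+ f (λ σ → - f σ) τ))
    (∂-zero (λ σ → f σ ⊕ - f σ) τ λ v → R.-‿inverseʳ _))

  -- Inserting any vertex other than `v` into `τ` gives a set that still misses `v`, where `f`
  -- vanishes; a single summand survives.
  ∂-star : ∀ (f : Subset n → Carrier) {v τ} → (∀ σ → v ∉ σ → f σ ≈ 0#) → v ∉ τ →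
           ∂ f τ ≈ sgn v τ ⊛ f (τ ∪ ⁅ v ⁆)
  ∂-star f {v} {τ} star v∉τ = R.trans
    (sum-single v (term f τ) λ u u≢v →
      term-zero f τ u (star _ (x∉p∪⁅y⁆ v∉τ (u≢v ∘ ≡.sym))))
    (term-∉ f v∉τ)

  -- Splitting chains at a vertex; links and cones.

  module _ (v : Fin n) where

    -- The sign in link makes link f = ∂ (off f) away from v for every cycle f.
    on off link cone : (Subset n → Carrier) → (Subset n → Carrier)
    on   f σ = if does (v ∈? σ) then f σ else 0#
    off  f σ = if does (v ∈? σ) then 0# else f σ
    link f τ = - term f τ v
    cone f σ = if does (v ∈? σ) then sgn v (σ - v) ⊛ f (σ - v) else 0#

    on-∉ : ∀ f σ → v ∉ σ → on f σ ≈ 0#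
    on-∉ f σ v∉σ with v ∈? σ
    ... | yes v∈σ = ⊥-elim (v∉σ v∈σ)
    ... | no _    = R.refl

    on-∈ : ∀ f {σ} → v ∈ σ → on f σ ≈ f σ
    on-∈ f {σ} v∈σ with v ∈? σ
    ... | yes _  = R.refl
    ... | no v∉σ = ⊥-elim (v∉σ v∈σ)

    off-∈ : ∀ f σ → v ∈ σ → off f σ ≈ 0#
    off-∈ f σ v∈σ with v ∈? σ
    ... | yes _  = R.refl
    ... | no v∉σ = ⊥-elim (v∉σ v∈σ)

    off-∉ : ∀ f {σ} → v ∉ σ → off f σ ≈ f σ
    off-∉ f {σ} v∉σ with v ∈? σ
    ... | yes v∈σ = ⊥-elim (v∉σ v∈σ)
    ... | no _    = R.refl

    cone-∉ : ∀ f σ → v ∉ σ → cone f σ ≈ 0#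
    cone-∉ f σ v∉σ with v ∈? σ
    ... | yes v∈σ = ⊥-elim (v∉σ v∈σ)
    ... | no _    = R.refl

    cone-∈ : ∀ f {τ} → v ∉ τ → cone f (τ ∪ ⁅ v ⁆) ≈ sgn v τ ⊛ f τ
    cone-∈ f {τ} v∉τ with v ∈? (τ ∪ ⁅ v ⁆)
    ... | yes _  = R.reflexive (≡.cong (λ σ → sgn v σ ⊛ f σ) (p∪⁅x⁆-x≡p v∉τ))
    ... | no v∉  = ⊥-elim (v∉ (x∈p∪⁅x⁆ τ))

    link-∈ : ∀ f {τ} → v ∈ τ → link f τ ≈ 0#
    link-∈ f v∈τ = R.trans (R.-‿cong (term-∈ f v∈τ)) ε⁻¹≈ε

    -- Write `f` as the sum of `off f` and `on f`. At a set missing `v`, the boundary of `on f` is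
    -- one summand, the negative of `link f`, and it has to cancel the boundary of `off f`.
    ∂-off : ∀ f {τ} → ∂ f τ ≈ 0# → v ∉ τ → ∂ (off f) τ ≈ link f τ
    ∂-off f {τ} ∂f≈0 v∉τ = inverseˡ-unique _ _ (begin
      ∂ (off f) τ ⊕ term f τ v                 ≈⟨ R.+-congˡ (term-∉ f v∉τ) ⟩
      ∂ (off f) τ ⊕ sgn v τ ⊛ f (τ ∪ ⁅ v ⁆)    ≈⟨ R.+-congˡ (R.*-congˡ (R.sym (on-∈ f (x∈p∪⁅x⁆ τ)))) ⟩
      ∂ (off f) τ ⊕ sgn v τ ⊛ on f (τ ∪ ⁅ v ⁆) ≈⟨ R.+-congˡ (R.sym (∂-star (on f) (on-∉ f) v∉τ)) ⟩
      ∂ (off f) τ ⊕ ∂ (on f) τ                 ≈⟨ R.sym (∂-+ (off f) (on f) τ) ⟩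
      ∂ (λ σ → off f σ ⊕ on f σ) τ             ≈⟨ ∂-cong split τ ⟩
      ∂ f τ                                    ≈⟨ ∂f≈0 ⟩
      0#                                       ∎)
      where
      split : ∀ σ → off f σ ⊕ on f σ ≈ f σ
      split σ with v ∈? σ
      ... | yes _ = R.+-identityˡ _
      ... | no _  = R.+-identityʳ _

    ∂-vanish-∈ : ∀ f {τ} → (∀ σ → v ∈ σ → f σ ≈ 0#) → v ∈ τ → ∂ f τ ≈ 0#
    ∂-vanish-∈ f {τ} h v∈τ = ∂-zero f τ λ u → h _ (p⊆p∪q _ v∈τ)

    -- The right-hand side is the negative of `link (∂ f) τ`, so `link` anticommutes with `∂` away
    -- from `v`. The equality holds summand by summand and rests on `sgn-swap`.
    ∂-link : ∀ f {τ} → v ∉ τ → ∂ (link f) τ ≈ sgn v τ ⊛ ∂ f (τ ∪ ⁅ v ⁆)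
    ∂-link f {τ} v∉τ = R.trans (sum-cong-≋ termwise)
      (R.sym (*-distribˡ-sum (sgn v τ) (term f (τ ∪ ⁅ v ⁆))))
      where
      both-zero : ∀ {a b} s → a ≈ 0# → b ≈ 0# → a ≈ s ⊛ b
      both-zero s a≈0 b≈0 = R.trans a≈0 (R.sym (R.trans (R.*-congˡ b≈0) (R.zeroʳ s)))
      termwise : ∀ u → term (link f) τ u ≈ sgn v τ ⊛ term f (τ ∪ ⁅ v ⁆) u
      termwise u with u ∈? τ | u Fin.≟ v
      ... | yes u∈τ | _ = both-zero _ R.refl (term-∈ f (p⊆p∪q _ u∈τ))
      ... | no _ | yes refl = both-zero _
        (R.trans (R.*-congˡ (link-∈ f (x∈p∪⁅x⁆ τ))) (R.zeroʳ _))
        (term-∈ f (x∈p∪⁅x⁆ τ))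
      ... | no u∉τ | no u≢v = begin
        su ⊛ - term f (τ ∪ ⁅ u ⁆) v
          ≈⟨ R.*-congˡ (R.-‿cong (term-∉ f (x∉p∪⁅y⁆ v∉τ (u≢v ∘ ≡.sym)))) ⟩
        su ⊛ - (svu ⊛ f ((τ ∪ ⁅ u ⁆) ∪ ⁅ v ⁆))
          ≈⟨ R.sym (-‿distribʳ-* _ _) ⟩
        - (su ⊛ (svu ⊛ f ((τ ∪ ⁅ u ⁆) ∪ ⁅ v ⁆)))
          ≈⟨ R.-‿cong (R.sym (R.*-assoc _ _ _)) ⟩
        - ((su ⊛ svu) ⊛ f ((τ ∪ ⁅ u ⁆) ∪ ⁅ v ⁆))
          ≈⟨ -‿distribˡ-* _ _ ⟩
        - (su ⊛ svu) ⊛ f ((τ ∪ ⁅ u ⁆) ∪ ⁅ v ⁆)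
          ≈⟨ R.*-cong (R.trans (R.-‿cong (sgn-swap u≢v u∉τ v∉τ)) (⁻¹-involutive _))
                      (R.reflexive (≡.cong f (∪⁅⁆-swap τ u v))) ⟩
        (sv ⊛ suv) ⊛ f ((τ ∪ ⁅ v ⁆) ∪ ⁅ u ⁆)
          ≈⟨ R.*-assoc _ _ _ ⟩
        sv ⊛ (suv ⊛ f ((τ ∪ ⁅ v ⁆) ∪ ⁅ u ⁆))
          ≈⟨ R.*-congˡ (R.sym (term-∉ f (x∉p∪⁅y⁆ u∉τ u≢v))) ⟩
        sv ⊛ term f (τ ∪ ⁅ v ⁆) u ∎
        where
        su = sgn u τ
        sv = sgn v τ
        svu = sgn v (τ ∪ ⁅ u ⁆)
        suv = sgn u (τ ∪ ⁅ v ⁆)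

    link-cycle : ∀ f → (∀ τ → ∂ f τ ≈ 0#) → ∀ τ → ∂ (link f) τ ≈ 0#
    link-cycle f ∂f≈0 τ with v ∈? τ
    ... | yes v∈τ = ∂-vanish-∈ (link f) (λ σ → link-∈ f) v∈τ
    ... | no v∉τ  = R.trans (∂-link f v∉τ) (R.trans (R.*-congˡ (∂f≈0 _)) (R.zeroʳ _))

    module _ {w : Subset n → Carrier} (w-∈ : ∀ σ → v ∈ σ → w σ ≈ 0#)
             {τ : Subset n} (v∉τ : v ∉ τ) where

      ∂-cone-∉ : ∂ (cone w) τ ≈ w τ
      ∂-cone-∉ = begin
        ∂ (cone w) τ                  ≈⟨ ∂-star (cone w) (cone-∉ w) v∉τ ⟩
        sgn v τ ⊛ cone w (τ ∪ ⁅ v ⁆)  ≈⟨ R.*-congˡ (cone-∈ w v∉τ) ⟩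
        sgn v τ ⊛ (sgn v τ ⊛ w τ)     ≈⟨ sgn-involutive v τ _ ⟩
        w τ                           ∎

      -- With `∂-cone-∉` this is the cone formula ∂ (cone w) = w - cone (∂ w). It follows from
      -- `∂-link`, because taking the link of `cone w` returns - w.
      ∂-cone-∈ : ∂ (cone w) (τ ∪ ⁅ v ⁆) ≈ - (sgn v τ ⊛ ∂ w τ)
      ∂-cone-∈ = begin
        ∂ (cone w) (τ ∪ ⁅ v ⁆)                          ≈⟨ R.sym (sgn-involutive v τ _) ⟩
        sgn v τ ⊛ (sgn v τ ⊛ ∂ (cone w) (τ ∪ ⁅ v ⁆))    ≈⟨ R.*-congˡ (R.sym (∂-link (cone w) v∉τ)) ⟩
        sgn v τ ⊛ ∂ (link (cone w)) τ                   ≈⟨ R.*-congˡ (∂-cong link-cone τ) ⟩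
        sgn v τ ⊛ ∂ (λ σ → - w σ) τ                     ≈⟨ R.*-congˡ (∂-neg w τ) ⟩
        sgn v τ ⊛ - ∂ w τ                               ≈⟨ R.sym (-‿distribʳ-* _ _) ⟩
        - (sgn v τ ⊛ ∂ w τ)                             ∎
        where
        link-cone : ∀ σ → link (cone w) σ ≈ - w σ
        link-cone σ with v ∈? σ
        ... | yes v∈σ = R.-‿cong (R.sym (w-∈ σ v∈σ))
        ... | no v∉σ  = R.-‿cong (R.trans (R.*-congˡ (cone-∈ w v∉σ)) (sgn-involutive v σ _))

    -- On sets missing `v`, the boundary of `cone w` restores the `w` that was subtracted from
    -- `off z`. On sets containing `v`, `∂ u` vanishes and `cone w` contributes - cone (link z),
    -- which is `z` there because the sign in `link` cancels the minus.
    ∂-glue : ∀ {z w u} → (∀ σ → v ∈ σ → w σ ≈ 0#) →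
             (∀ τ → v ∉ τ → ∂ w τ ≈ link z τ) →
             (∀ τ → ∂ u τ ≈ off z τ ⊕ - w τ) →
             ∀ τ → ∂ (λ σ → u σ ⊕ cone w σ) τ ≈ z τ
    ∂-glue {z} {w} {u} w-∈ ∂w ∂u τ = R.trans (∂-+ u (cone w) τ) (by-cases (v ∈? τ))
      where
      by-cases : Dec (v ∈ τ) → ∂ u τ ⊕ ∂ (cone w) τ ≈ z τ
      by-cases (no v∉τ) = begin
        ∂ u τ ⊕ ∂ (cone w) τ       ≈⟨ R.+-cong (∂u τ) (∂-cone-∉ w-∈ v∉τ) ⟩
        (off z τ ⊕ - w τ) ⊕ w τ    ≈⟨ R.+-assoc _ _ _ ⟩
        off z τ ⊕ (- w τ ⊕ w τ)    ≈⟨ R.+-congˡ (R.-‿inverseˡ _) ⟩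
        off z τ ⊕ 0#               ≈⟨ R.+-identityʳ _ ⟩
        off z τ                    ≈⟨ off-∉ z v∉τ ⟩
        z τ                        ∎
      by-cases (yes v∈τ) = begin
        ∂ u τ ⊕ ∂ (cone w) τ       ≈⟨ R.+-congʳ (∂u τ) ⟩
        (off z τ ⊕ - w τ) ⊕ ∂ (cone w) τ
          ≈⟨ R.+-congʳ (R.+-cong (off-∈ z τ v∈τ) (R.trans (R.-‿cong (w-∈ τ v∈τ)) ε⁻¹≈ε)) ⟩
        (0# ⊕ 0#) ⊕ ∂ (cone w) τ   ≈⟨ R.trans (R.+-congʳ (R.+-identityˡ _)) (R.+-identityˡ _) ⟩
        ∂ (cone w) τ               ≈⟨ R.reflexive (≡.cong (∂ (cone w)) (≡.sym τ≡)) ⟩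
        ∂ (cone w) (ρ ∪ ⁅ v ⁆)     ≈⟨ ∂-cone-∈ w-∈ v∉ρ ⟩
        - (sgn v ρ ⊛ ∂ w ρ)        ≈⟨ R.-‿cong (R.*-congˡ (R.trans (∂w ρ v∉ρ) (R.-‿cong (term-∉ z v∉ρ)))) ⟩
        - (sgn v ρ ⊛ - (sgn v ρ ⊛ z (ρ ∪ ⁅ v ⁆)))
          ≈⟨ R.-‿cong (R.sym (-‿distribʳ-* _ _)) ⟩
        - - (sgn v ρ ⊛ (sgn v ρ ⊛ z (ρ ∪ ⁅ v ⁆)))
          ≈⟨ R.trans (⁻¹-involutive _) (sgn-involutive v ρ _) ⟩
        z (ρ ∪ ⁅ v ⁆)              ≈⟨ R.reflexive (≡.cong z τ≡) ⟩
        z τ                        ∎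
        where
        ρ = τ - v
        v∉ρ : v ∉ ρ
        v∉ρ = x∉p-x τ
        τ≡ : ρ ∪ ⁅ v ⁆ ≡ τ
        τ≡ = p-x∪⁅x⁆≡p v∈τ

  -- Vanishing of homology by removing a vertex.

  module _ {n} (G : Graph n) where

    open Graph G
    open GraphProperties G

    -- As in NonzeroH̃, the index is shifted: this says H̃_{j−1} = 0.
    Acyclic : Subset n → ℕ → Set _
    Acyclic S j = ¬ NonzeroH̃ (Ind G S) j

    -- The `supported` field of `Chain` for a bare coefficient function, so that `off`, `link` and
    -- `cone` can be handled before a chain is assembled.
    SupportedOn : Subset n → ℕ → (Subset n → Carrier) → Set _
    SupportedOn S j f = ∀ σ → ¬ (Face S σ × ∣ σ ∣ ≡ j) → f σ ≈ 0#

    off-supported : ∀ {S j f} v → SupportedOn S j f → SupportedOn (S - v) j (off v f)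
    off-supported v f-supp σ h with v ∈? σ
    ... | yes _  = R.refl
    ... | no v∉σ = f-supp σ λ ((σ⊆S , ind) , ∣σ∣) →
      h (((λ x∈σ → x∈p∧x≢y⇒x∈p-y (σ⊆S x∈σ) λ { refl → v∉σ x∈σ }) , ind) , ∣σ∣)

    link-supported : ∀ {S j f} v → SupportedOn S (suc j) f →
                     SupportedOn (S ─ N[ G ] v) j (link v f)
    link-supported {f = f} v f-supp τ h with v ∈? τ
    ... | yes _  = ε⁻¹≈ε
    ... | no v∉τ = R.trans (R.-‿cong (R.trans (R.*-congˡ fτv≈0) (R.zeroʳ _))) ε⁻¹≈ε
      where
      fτv≈0 : f (τ ∪ ⁅ v ⁆) ≈ 0#
      fτv≈0 = f-supp _ λ (face , card) → h (face-link v∉τ face ,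
        ℕₚ.suc-injective (≡.trans (≡.sym (∣p∪⁅x⁆∣≡1+∣p∣ v∉τ)) card))

    cone-supported : ∀ {S j w v} → v ∈ S → SupportedOn (S ─ N[ G ] v) j w →
                     SupportedOn S (suc j) (cone v w)
    cone-supported {v = v} v∈S w-supp σ h with v ∈? σ
    ... | no _    = R.refl
    ... | yes v∈σ = R.trans (R.*-congˡ (w-supp (σ - v) λ (face , card) → h
      ( ≡.subst (Face _) (p-x∪⁅x⁆≡p v∈σ) (face-cone v∈S face)
      , ≡.trans (≡.cong ∣_∣ (≡.sym (p-x∪⁅x⁆≡p v∈σ)))
          (≡.trans (∣p∪⁅x⁆∣≡1+∣p∣ (x∉p-x σ)) (≡.cong suc card))))) (R.zeroʳ _)

    supported-mono : ∀ {S T j f} → S ⊆ T → SupportedOn S j f → SupportedOn T j f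
    supported-mono S⊆T f-supp σ h = f-supp σ λ (face , card) → h (face-mono S⊆T face , card)

    -- Adds the supports to `∂-glue`: `w` lives on the link, so its cone consists of faces of
    -- `Ind G S`.
    boundary-from-glue : ∀ {S j v w u} (z : Chain (Ind G S) j) → v ∈ S →
      SupportedOn (S ─ N[ G ] v) j w → SupportedOn S (suc j) u →
      (∀ τ → v ∉ τ → ∂ w τ ≈ link v (coeff z) τ) →
      (∀ τ → ∂ u τ ≈ off v (coeff z) τ ⊕ - w τ) →
      IsBoundary (Ind G S) z
    boundary-from-glue {S} {v = v} {w} {u} z v∈S w-supp u-supp ∂w ∂u =
      record { coeff     = λ σ → u σ ⊕ cone v w σ
             ; supported = λ σ h → R.trans
                 (R.+-cong (u-supp σ h) (cone-supported v∈S w-supp σ h)) (R.+-identityˡ _) }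
      , ∂-glue v {u = u} w-∈ ∂w ∂u
      where
      w-∈ : ∀ σ → v ∈ σ → w σ ≈ 0#
      w-∈ σ v∈σ = w-supp σ λ ((σ⊆L , _) , _) →
        x∈p─q⇒x∉q S _ (σ⊆L v∈σ) (∈N⁺ (inj₁ refl))

    -- `Ind G S` is a cone with apex `v`, hence contractible.
    isolated⇒acyclic : ∀ {S v} j → v ∈ S → (∀ {x} → x ∈ S → ¬ v ~ x) → Acyclic S j
    isolated⇒acyclic {S} {v} j v∈S isolated (z , cycle , ¬boundary) = ¬boundary
      -- Here `w` is `off v (coeff z)`: since `v` is isolated, deleting it already gives its link.
      -- Nothing remains for `u` to fill.
      (boundary-from-glue {u = λ _ → 0#} z v∈S
        (supported-mono deletion⊆link (off-supported v (supported z)))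
        (λ _ _ → R.refl)
        (λ τ → ∂-off v (coeff z) (cycle τ))
        (λ τ → R.trans (∂-zero (λ _ → 0#) τ λ _ → R.refl) (R.sym (R.-‿inverseʳ _))))
      where
      deletion⊆link : S - v ⊆ S ─ N[ G ] v
      deletion⊆link x∈ = x∈p∧x∉q⇒x∈p─q (p─q⊆p S _ x∈)
        ([ (λ { refl → x∉p-x S x∈ }) , isolated (p─q⊆p S _ x∈) ]′ ∘ ∈N⁻)

    -- A chase in the exact sequence of `v`. The link of the cycle `z` is a cycle; if `w` fills it,
    -- then `off z` - `w` is a cycle on `S - v`; if `u` fills that one, `u` plus the cone of `w`
    -- fills `z`.
    acyclic-step : ∀ {S v j} → v ∈ S →
      Acyclic (S - v) (suc j) → Acyclic (S ─ N[ G ] v) j → Acyclic S (suc j)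
    acyclic-step {S} {v} {j} v∈S del lk (z , cycle , ¬boundary) =
      -- Acyclicity is a negation and yields no filling outright. Each assumption is therefore
      -- contradicted by a cycle whose hypothetical filling leads on to the next stage.
      lk ( record { coeff = link v (coeff z) ; supported = link-supported v (supported z) }
         , link-cycle v (coeff z) cycle
         , λ (w , ∂w) → del (rest w , rest-cycle w ∂w
         , λ (u , ∂u) → ¬boundary (boundary-from-glue z v∈S (supported w)
             (supported-mono (p─q⊆p S _) (supported u)) (λ τ _ → ∂w τ) ∂u)))
      where
      rest : Chain (Ind G (S ─ N[ G ] v)) (suc j) → Chain (Ind G (S - v)) (suc j)
      rest w = record
        { coeff     = λ σ → off v (coeff z) σ ⊕ - coeff w σ
        ; supported = λ σ h → R.trans
            (R.+-cong (off-supported v (supported z) σ h)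
              (R.trans (R.-‿cong (supported-mono ─N⊆- (supported w) σ h)) ε⁻¹≈ε))
            (R.+-identityˡ _)
        }
      rest-cycle : ∀ w → (∀ τ → ∂ (coeff w) τ ≈ link v (coeff z) τ) →
                   IsCycle (Ind G (S - v)) (rest w)
      rest-cycle w ∂w τ with v ∈? τ
      ... | yes v∈τ = ∂-vanish-∈ v (coeff (rest w)) (λ σ v∈σ → supported (rest w) σ
              λ ((σ⊆ , _) , _) → x∉p-x S (σ⊆ v∈σ)) v∈τ
      ... | no v∉τ  = begin
        ∂ (coeff (rest w)) τ
          ≈⟨ ∂-+ (off v (coeff z)) (λ σ → - coeff w σ) τ ⟩
        ∂ (off v (coeff z)) τ ⊕ ∂ (λ σ → - coeff w σ) τ
          ≈⟨ R.+-cong (∂-off v (coeff z) (cycle τ) v∉τ)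
                      (R.trans (∂-neg (coeff w) τ) (R.-‿cong (∂w τ))) ⟩
        link v (coeff z) τ ⊕ - link v (coeff z) τ
          ≈⟨ R.-‿inverseʳ _ ⟩
        0# ∎

    -- Every vertex of a nonempty edgeless `S` is isolated. For empty `S` the only face is the empty
    -- one, with homology at index 0, hence the index `suc j`.
    edgeless⇒acyclic : ∀ {S} j → (∀ {x y} → x ∈ S → y ∈ S → ¬ x ~ y) → Acyclic S (suc j)
    edgeless⇒acyclic {S} j edgeless with nonempty? S
    ... | yes (v , v∈S) = isolated⇒acyclic (suc j) v∈S (edgeless v∈S)
    ... | no empty      = λ (z , _ , ¬boundary) → ¬boundary
      ( record { coeff = λ _ → 0# ; supported = λ _ _ → R.refl }
      , λ τ → R.trans (∂-zero (λ _ → 0#) τ λ _ → R.refl)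
          (R.sym (supported z τ λ ((τ⊆S , _) , ∣τ∣) →
            ℕₚ.0≢1+n (≡.trans (≡.sym (empty⇒∣p∣≡0 λ (x , x∈τ) → empty (x , τ⊆S x∈τ))) ∣τ∣))))

    -- Vanishing bounds for graphs without induced `2K₂`.

    module _ (2K₂-free : ¬ HasInduced 2K₂ G) where

      module _ (C : Subset n) where

        open Cover C

        -- With no edge inside C ∩ S, the neighbours in S of c ∈ C ∩ S are adjacent
        -- to d by 2K₂-freeness, so c is isolated in S ─ N[ d ].
        dominated⇒acyclic : ∀ {S c d e} j → Covers S → ¬ HasEdge (C ∩ S) →
          c ∈ C ∩ S → d ∈ S ─ N[ G ] c → e ∈ S ─ N[ G ] c → d ~ e → d ∈ C →
          (∀ {b} → b ∈ C ∩ S → Acyclic (S - b) (suc j)) → Acyclic S (suc j)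
        dominated⇒acyclic {S} {c} {d} {e} j cov ¬edge c∈ d∈L e∈L d~e d∈C del =
          acyclic-step d∈S (del d∈) (isolated⇒acyclic j c∈S─N isolated)
          where
          c∈S = p∩q⊆q C S c∈
          d∈S = p─q⊆p S _ d∈L
          e∈S = p─q⊆p S _ e∈L
          d∈  = x∈p∩q⁺ (d∈C , d∈S)
          d∉N = x∈p─q⇒x∉q S _ d∈L
          e∉N = x∈p─q⇒x∉q S _ e∈L
          c∈S─N : c ∈ S ─ N[ G ] d
          c∈S─N = x∈p∧x∉q⇒x∈p─q c∈S
            ([ (λ { refl → d∉N (∈N⁺ (inj₁ refl)) })
             , (λ d~c → d∉N (∈N⁺ (inj₂ (~-sym d~c)))) ]′ ∘ ∈N⁻)
          ∉C : ∀ {b x} → b ∈ C ∩ S → x ∈ S → b ~ x → x ∉ C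
          ∉C b∈ x∈S b~x x∈C = ¬edge (_ , _ , b∈ , x∈p∩q⁺ (x∈C , x∈S) , b~x)
          isolated : ∀ {x} → x ∈ S ─ N[ G ] d → ¬ c ~ x
          isolated {x} x∈L c~x with 2K₂-free⇒linked 2K₂-free c~x d~e
          ... | inj₁ (inj₁ c~d) = d∉N (∈N⁺ (inj₂ c~d))
          ... | inj₁ (inj₂ c~e) = e∉N (∈N⁺ (inj₂ c~e))
          ... | inj₂ (inj₁ x~d) = x∈p─q⇒x∉q S _ x∈L (∈N⁺ (inj₂ (~-sym x~d)))
          -- The edge from `x` to `e` forces one of them into `C`, but `x` is a neighbour of `c` and
          -- `e` is a neighbour of `d`, both in the edgeless `C ∩ S`.
          ... | inj₂ (inj₂ x~e) = [ ∉C c∈ x∈S c~x , ∉C d∈ e∈S d~e ]′ (cov x∈S e∈S x~e)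
            where x∈S = p─q⊆p S _ x∈L

        -- The numerical hypothesis says that `j` exceeds half of `∣ C ∩ S ∣` plus 1, the bound on
        -- the regularity given by a cover.
        cover⇒acyclic : ∀ {S} j → Covers S → 3 + ∣ C ∩ S ∣ ≤ 2 * j → Acyclic S j
        cover⇒acyclic {S} j = go S j (<-wellFounded _)
          where
          go : ∀ S j → Acc _<_ ∣ C ∩ S ∣ → Covers S → 3 + ∣ C ∩ S ∣ ≤ 2 * j → Acyclic S j
          -- The bound excludes the indices 0 and 1. A link, one index lower, thus still has
          -- positive index, as `edgeless⇒acyclic` requires.
          go S zero _ _ ()
          go S (suc zero) _ _ (s≤s (s≤s ()))
          go S (suc (suc j)) (acc rec) cov bound = by-cases (nonempty? (C ∩ S)) (hasEdge? (C ∩ S))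
            where
            del : ∀ {c} → c ∈ C ∩ S → Acyclic (S - c) (2 + j)
            del {c} c∈ = go (S - c) (2 + j) (rec smaller) (covers-anti (p─q⊆p S _) cov)
              (ℕₚ.≤-trans (ℕₚ.+-monoʳ-≤ 3 (ℕₚ.<⇒≤ smaller)) bound)
              where
              smaller : ∣ C ∩ (S - c) ∣ < ∣ C ∩ S ∣
              smaller = let c∈C , c∈S = x∈p∩q⁻ C S c∈ in ∣C∩S-c∣<∣C∩S∣ c∈C c∈S
            by-cases : Dec (Nonempty (C ∩ S)) → Dec (HasEdge (C ∩ S)) → Acyclic S (2 + j)
            by-cases (no empty) _ = edgeless⇒acyclic (suc j) λ x∈S y∈S x~y →
              [ (λ x∈C → empty (_ , x∈p∩q⁺ (x∈C , x∈S)))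
              , (λ y∈C → empty (_ , x∈p∩q⁺ (y∈C , y∈S))) ]′ (cov x∈S y∈S x~y)
            by-cases (yes _) (yes (c , d , c∈ , d∈ , c~d)) =
              acyclic-step (p∩q⊆q C S c∈) (del c∈)
                (go (S ─ N[ G ] c) (suc j) (rec (ℕₚ.≤-trans (ℕₚ.n≤1+n _) drop))
                  (covers-anti (p─q⊆p S _) cov)
                  (ℕₚ.≤-trans (s≤s drop) (2+m≤2*[1+k]⇒m≤2*k {k = suc j} bound)))
              where drop = 2+∣C∩S─N∣≤∣C∩S∣ c∈ d∈ c~d
            by-cases (yes (c , c∈)) (no ¬edge) with hasEdge? (S ─ N[ G ] c)
            ... | no edgeless = acyclic-step (p∩q⊆q C S c∈) (del c∈)
                    (edgeless⇒acyclic j λ x∈ y∈ x~y → edgeless (_ , _ , x∈ , y∈ , x~y))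
            -- Some endpoint of this edge is in `C`. That endpoint is removed instead of `c`, and
            -- `c` becomes isolated in its link.
            ... | yes (x , y , x∈ , y∈ , x~y) with cov (p─q⊆p S _ x∈) (p─q⊆p S _ y∈) x~y
            ...   | inj₁ x∈C = dominated⇒acyclic (suc j) cov ¬edge c∈ x∈ y∈ x~y x∈C del
            ...   | inj₂ y∈C = dominated⇒acyclic (suc j) cov ¬edge c∈ y∈ x∈ (~-sym x~y) y∈C del

      -- Endpoints of edges are deleted one by one at constant index until `S` is edgeless. Each
      -- link on the way has a small cover and one index less, which turns the 5 into the 3 of
      -- `cover⇒acyclic`.
      privacy⇒acyclic : ∀ {S} j → 5 + maxPrivacyDegree G ≤ 2 * j → Acyclic S j
      privacy⇒acyclic {S} j bound = go S j (<-wellFounded _) bound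
        where
        go : ∀ S j → Acc _<_ ∣ S ∣ → 5 + maxPrivacyDegree G ≤ 2 * j → Acyclic S j
        go S zero _ ()
        go S (suc j) (acc rec) bound with hasEdge? S
        ... | no edgeless = edgeless⇒acyclic j λ x∈ y∈ x~y → edgeless (_ , _ , x∈ , y∈ , x~y)
        ... | yes (x , y , x∈S , y∈S , x~y) = acyclic-step x∈S
          (go (S - x) (suc j) (rec (x∈p⇒∣p-x∣<∣p∣ x∈S)) bound)
          -- All of `N[ G ] y` serves as the cover; only its part in `L` is counted, and that part
          -- avoids `N[ G ] x`.
          (cover⇒acyclic (N[ G ] y) j cov
            (ℕₚ.≤-trans (ℕₚ.+-monoʳ-≤ 3 private≤) (2+m≤2*[1+k]⇒m≤2*k bound)))
          where
          L = S ─ N[ G ] x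
          x≁ : ∀ {u} → u ∈ L → ¬ x ~ u
          x≁ u∈L x~u = x∈p─q⇒x∉q S _ u∈L (∈N⁺ (inj₂ x~u))
          cov : Cover.Covers (N[ G ] y) L
          cov u∈L v∈L u~v with 2K₂-free⇒linked 2K₂-free x~y u~v
          ... | inj₁ (inj₁ x~u) = ⊥-elim (x≁ u∈L x~u)
          ... | inj₁ (inj₂ x~v) = ⊥-elim (x≁ v∈L x~v)
          ... | inj₂ (inj₁ y~u) = inj₁ (∈N⁺ (inj₂ y~u))
          ... | inj₂ (inj₂ y~v) = inj₂ (∈N⁺ (inj₂ y~v))
          private≤ : ∣ N[ G ] y ∩ L ∣ ≤ maxPrivacyDegree G
          private≤ = ℕₚ.≤-trans
            (p⊆q⇒∣p∣≤∣q∣ λ u∈ → let u∈N , u∈L = x∈p∩q⁻ (N[ G ] y) L u∈ in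
              x∈p∧x∉q⇒x∈p─q u∈N (x∈p─q⇒x∉q S _ u∈L))
            (∣N─N∣≤maxPrivacyDegree (~-sym x~y))

mainTheorem19 : ∀ {c ℓ₁ ℓ₂} (K : HeytingField c ℓ₁ ℓ₂) {n : ℕ} (G : Graph n) →
    ¬ HasInduced 2K₂ G →
    ∀ (r : ℕ) → IsReg K G r → 2 * r ≤ maxPrivacyDegree G + 4
mainTheorem19 K G 2K₂-free r ((S , H̃≢0) , _) = ℕₚ.≮⇒≥ λ Γ+4<2r →
  -- If the inequality failed, 5 + Γ would be at most 2r, and the homology that attains the
  -- regularity would vanish.
  privacy⇒acyclic K G 2K₂-free r
    (≡.subst (_≤ 2 * r) (≡.cong suc (ℕₚ.+-comm (maxPrivacyDegree G) 4)) Γ+4<2r) H̃≢0
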